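{- There exists $\varepsilon_0>0$ such that the following holds for every constant $\varepsilon\in(0,\varepsilon_0)$. Let $G$ be a graph on $n$ vertices with maximum degree $d\ge 3$ (where $d$ may depend on $n$). Let $p=\frac{1-\varepsilon}{d-1}$, and form a random subgraph $G_p$ of $G$ by retaining every edge of $G$ independently with probability $p$. Then with high probability (i.e., with probability tending to $1$ as $n\to\infty$), every connected component of $G_p$ has at most $\frac{9\ln n}{\varepsilon^2}$ vertices.
   Context: "With high probability" means with probability $1-o(1)$ as $n\to\infty$, uniformly over the graphs $G$ considered.
   Formalization: The constant ε (and hence the retention probability p) ranges over rational numbers only, instead of all real ε in (0, ε₀). -}

module Defs where

open import Data.Bool using (Bool; true; false; _∧_; _∨_; if_then_else_)
open import Data.Nat as ℕ using (ℕ; zero; suc; _⊔_; _∸_; _<ᵇ_)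

open import Data.Fin using (Fin; toℕ)
open import Data.Fin.Properties using (_≟_)
open import Data.List using (List; []; _∷_; map; foldr; allFin; concatMap)
open import Data.Bool.ListAction using (any)
open import Data.Product using (_×_; _,_)
open import Data.Integer using (+_)
open import Data.Rational using (ℚ; _/_; _+_; _*_; _-_; 0ℚ; 1ℚ; _≤_)
open import Relation.Nullary.Decidable using (⌊_⌋)
open import Relation.Binary.PropositionalEquality using (_≡_)

record Graph (n : ℕ) : Set where
  field
    adj    : Fin n → Fin n → Bool
    adj-sym : ∀ i j → adj i j ≡ adj j i
    irrefl : ∀ i → adj i i ≡ false
open Graph public

countTrue : List Bool → ℕ
countTrue = foldr (λ b k → if b then suc k else k) 0

degree : ∀ {n} → Graph n → Fin n → ℕ
degree {n} G i = countTrue (map (adj G i) (allFin n))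

maxDegree : ∀ {n} → Graph n → ℕ
maxDegree {n} G = foldr _⊔_ 0 (map (degree G) (allFin n))

Edge : ℕ → Set
Edge n = Fin n × Fin n

edges : ∀ {n} → Graph n → List (Edge n)
edges {n} G = concatMap (λ i → concatMap (λ j →
  if adj G i j ∧ (toℕ i <ᵇ toℕ j) then (i , j) ∷ [] else []) (allFin n)) (allFin n)

-- Expectation of f(S), where S is the random set of retained edges, every
-- edge of the list being retained independently with probability p.
expect : ∀ {A : Set} → ℚ → (List A → ℚ) → List A → List A → ℚ
expect p f acc [] = f acc
expect p f acc (e ∷ es) = p * expect p f (e ∷ acc) es + (1ℚ - p) * expect p f acc es

prob : ∀ {n} → Graph n → ℚ → (List (Edge n) → Bool) → ℚ
prob G p g = expect p (λ S → if g S then 1ℚ else 0ℚ) [] (edges G)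

adjS : ∀ {n} → List (Edge n) → Fin n → Fin n → Bool
adjS S u w = any (λ { (a , b) → (⌊ a ≟ u ⌋ ∧ ⌊ b ≟ w ⌋) ∨ (⌊ a ≟ w ⌋ ∧ ⌊ b ≟ u ⌋) }) S

reach : ∀ {n} → List (Edge n) → ℕ → Fin n → Fin n → Bool
reach S zero v u = ⌊ v ≟ u ⌋
reach {n} S (suc k) v u =
  reach S k v u ∨ any (λ w → reach S k v w ∧ adjS S w u) (allFin n)

-- Number of vertices of the connected component of v in (Fin n, S)
-- (a path of length ≤ n suffices to reach every vertex of the component).
componentSize : ∀ {n} → List (Edge n) → Fin n → ℕ
componentSize {n} S v = countTrue (map (reach S n v) (allFin n))

ℕtoℚ : ℕ → ℚ
ℕtoℚ k = + k / 1

-- 1/k for k ≥ 1 (value 0 at k = 0, never used there).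
inv : ℕ → ℚ
inv zero = 0ℚ
inv (suc k) = + 1 / suc k

expTerm : ℚ → ℕ → ℚ
expTerm x zero = 1ℚ
expTerm x (suc j) = expTerm x j * x * inv (suc j)

expPartial : ℚ → ℕ → ℚ
expPartial x zero = 0ℚ
expPartial x (suc k) = expPartial x k + expTerm x k

-- e^x ≤ m, for x ≥ 0: every partial sum of the exponential series is ≤ m.
ExpLe : ℚ → ℕ → Set
ExpLe x m = ∀ k → expPartial x k ≤ ℕtoℚ m

-- s ≤ 9 ln n / ε²  ⇔  e^(s ε² / 9) ≤ n.
SizeBound : ℚ → ℕ → ℕ → Set
SizeBound ε n s = ExpLe (ℕtoℚ s * ε * ε * inv 9) n

AllComponentsSmall : ∀ {n} → ℚ → List (Edge n) → Set
AllComponentsSmall {n} ε S = ∀ v → SizeBound ε n (componentSize S v)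

pOf : ℚ → ℕ → ℚ
pOf ε d = (1ℚ - ε) * inv (d ∸ 1)

{-# OPTIONS --safe #-}

-- Put u = 1 + ε²/8 and z = u². As e^(ε²/9) ≤ u, a vertex v lies in a small
-- component as soon as u^|C(v)| ≤ n, so by Markov's inequality and a union bound
-- it suffices that E[z^|C(v)|] ≤ 4, which makes the failure probability ≤ 4/n.
-- For the moment bound, explore C(v) one boundary edge at a time. With
-- w = 1 + pε, the expected final weight of a state with s found vertices and m
-- unrevealed boundary edges is at most z^s w^m: a retained edge yields a new
-- vertex with at most d-1 further edges, and p · z w^(d-1) + (1-p) ≤ w because
-- z w^(d-1) ≤ z (1 + a + 3a²/5) ≤ 1 + ε, where a = (d-1)pε = ε - ε².

module Submission where

open import Defs
open import Algebra.Bundles using (CommutativeRing)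
open import Data.Bool using (Bool; true; false; T; _∧_; _∨_; _xor_; if_then_else_)
open import Data.Bool.ListAction using (any; or; all)
open import Data.Fin using (Fin; toℕ)
open import Data.Fin.Properties using (_≟_)
import Data.Integer as ℤ
import Data.Integer.Properties as ℤP
open import Data.List using (List; []; _∷_; map; foldr; allFin; concatMap; _++_; length)
open import Data.List.Membership.Propositional using (_∈_)
open import Data.List.Membership.Propositional.Properties using (∈-allFin)
open import Data.List.Properties using (map-++; map-cong; length-tabulate)
open import Data.List.Relation.Binary.Permutation.Propositional as ↭ using (_↭_; ↭-refl; ↭-prep; ↭-swap; prep; swap)
open import Data.List.Relation.Binary.Permutation.Propositional.Properties using (shift; ↭-length; map⁺)
open import Data.List.Relation.Unary.All as All using (All; []; _∷_)
open import Data.List.Relation.Unary.AllPairs using ([]; _∷_)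
open import Data.List.Relation.Unary.Any using (here; there)
open import Data.List.Relation.Unary.Unique.Propositional using (Unique)
open import Data.List.Relation.Unary.Unique.Propositional.Properties using (allFin⁺)
open import Data.Nat as ℕ using (ℕ; zero; suc; z≤n; s≤s; _⊔_; _<ᵇ_)
open import Data.Nat.ListAction using (sum)
open import Data.Nat.ListAction.Properties using (sum-++; sum-↭)
import Data.Nat.Properties as ℕP
open import Data.Product using (Σ; ∃; _×_; _,_; proj₁; proj₂)
open import Data.Rational using (ℚ; mkℚ; 0ℚ; 1ℚ; _+_; _*_; _-_; -_; _/_; _≤_; _≤?_; _<_; toℚᵘ; nonNegative; positive; *<*)
open import Data.Rational.Properties hiding (_≟_)
open import Data.Rational.Solver using (module +-*-Solver)
import Data.Rational.Unnormalised as ℚᵘ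
import Data.Rational.Unnormalised.Properties as ℚᵘP
open import Data.Sum using (_⊎_; inj₁; inj₂)
open import Function using (_∘_)
open import Relation.Binary.PropositionalEquality
open import Relation.Nullary using (yes; no; contradiction)
open import Relation.Nullary.Decidable using (⌊_⌋; toWitness)
open import Algebra.Properties.CommutativeSemigroup ℕP.+-commutativeSemigroup using () renaming (interchange to ℕ-+-interchange)
open import Algebra.Properties.CommutativeSemiring.Exp (CommutativeRing.commutativeSemiring +-*-commutativeRing) using (_^_; ^-homo-*; ^-distrib-*)

private variable
  X Y : Set

-- Order and powers of rationals

0≤1 : 0ℚ ≤ 1ℚ
0≤1 = nonNegative⁻¹ 1ℚ

0≤a+b : ∀ {a b} → 0ℚ ≤ a → 0ℚ ≤ b → 0ℚ ≤ a + b
0≤a+b = +-mono-≤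

*-monoʳ-≤ : ∀ {r a b} → 0ℚ ≤ r → a ≤ b → r * a ≤ r * b
*-monoʳ-≤ {r} 0≤r = *-monoˡ-≤-nonNeg r {{nonNegative 0≤r}}

*-monoˡ-≤ : ∀ {r a b} → 0ℚ ≤ r → a ≤ b → a * r ≤ b * r
*-monoˡ-≤ {r} 0≤r = *-monoʳ-≤-nonNeg r {{nonNegative 0≤r}}

*-mono-≤ : ∀ {a b c d} → 0ℚ ≤ c → 0ℚ ≤ b → a ≤ b → c ≤ d → a * c ≤ b * d
*-mono-≤ 0≤c 0≤b a≤b c≤d = ≤-trans (*-monoˡ-≤ 0≤c a≤b) (*-monoʳ-≤ 0≤b c≤d)

0≤a*b : ∀ {a b} → 0ℚ ≤ a → 0ℚ ≤ b → 0ℚ ≤ a * b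
0≤a*b {a} 0≤a 0≤b = subst (_≤ a * _) (*-zeroʳ a) (*-monoʳ-≤ 0≤a 0≤b)

a≤a+b : ∀ {a b} → 0ℚ ≤ b → a ≤ a + b
a≤a+b {a} 0≤b = subst (_≤ a + _) (+-identityʳ a) (+-monoʳ-≤ a 0≤b)

-- Polynomial inequalities below go through this: the difference of the two sides is given as a
-- visibly nonnegative `r`, and the remaining identity is left to the ring solver.
+-slack⇒≤ : ∀ {a b} r → 0ℚ ≤ r → a + r ≡ b → a ≤ b
+-slack⇒≤ r 0≤r refl = a≤a+b 0≤r

a≤b⇒0≤b-a : ∀ {a b} → a ≤ b → 0ℚ ≤ b - a
a≤b⇒0≤b-a {a} {b} a≤b = subst (_≤ b - a) (+-inverseʳ a) (+-monoˡ-≤ (- a) a≤b)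

0≤^ : ∀ {a} n → 0ℚ ≤ a → 0ℚ ≤ a ^ n
0≤^ zero    0≤a = 0≤1
0≤^ (suc n) 0≤a = 0≤a*b 0≤a (0≤^ n 0≤a)

1≤^ : ∀ {a} n → 1ℚ ≤ a → 1ℚ ≤ a ^ n
1≤^ zero    1≤a = ≤-refl
1≤^ {a} (suc n) 1≤a = *-mono-≤ 0≤1 (≤-trans 0≤1 1≤a) 1≤a (1≤^ n 1≤a)

^-monoʳ-≤ : ∀ {a m n} → 1ℚ ≤ a → m ℕ.≤ n → a ^ m ≤ a ^ n
^-monoʳ-≤ {n = n} 1≤a ℕ.z≤n = 1≤^ n 1≤a
^-monoʳ-≤ 1≤a (ℕ.s≤s m≤n) = *-monoʳ-≤ (≤-trans 0≤1 1≤a) (^-monoʳ-≤ 1≤a m≤n)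

-- Naturals and their reciprocals in ℚ, and the Archimedean property

ℕtoℚ-homo-+ : ∀ m n → ℕtoℚ (m ℕ.+ n) ≡ ℕtoℚ m + ℕtoℚ n
ℕtoℚ-homo-+ m n = toℚᵘ-injective (begin
  toℚᵘ (ℕtoℚ (m ℕ.+ n))                        ≈⟨ toℚᵘ-fromℚᵘ (ℚᵘ.mkℚᵘ (ℤ.+ (m ℕ.+ n)) 0) ⟩
  ℚᵘ.mkℚᵘ (ℤ.+ (m ℕ.+ n)) 0                      ≈⟨ ℚᵘ.*≡* (cong (ℤ._* ℤ.+ 1) (sym (cong₂ ℤ._+_ (ℤP.*-identityʳ (ℤ.+ m)) (ℤP.*-identityʳ (ℤ.+ n))))) ⟩
  ℚᵘ.mkℚᵘ (ℤ.+ m) 0 ℚᵘ.+ ℚᵘ.mkℚᵘ (ℤ.+ n) 0         ≈⟨ ℚᵘP.+-cong (toℚᵘ-fromℚᵘ (ℚᵘ.mkℚᵘ (ℤ.+ m) 0)) (toℚᵘ-fromℚᵘ (ℚᵘ.mkℚᵘ (ℤ.+ n) 0)) ⟨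
  toℚᵘ (ℕtoℚ m) ℚᵘ.+ toℚᵘ (ℕtoℚ n)             ≈⟨ toℚᵘ-homo-+ (ℕtoℚ m) (ℕtoℚ n) ⟨
  toℚᵘ (ℕtoℚ m + ℕtoℚ n)                       ∎)
  where open ℚᵘP.≃-Reasoning

ℕtoℚ-suc : ∀ n → ℕtoℚ (suc n) ≡ 1ℚ + ℕtoℚ n
ℕtoℚ-suc = ℕtoℚ-homo-+ 1

0≤ℕtoℚ : ∀ n → 0ℚ ≤ ℕtoℚ n
0≤ℕtoℚ zero    = ≤-refl
0≤ℕtoℚ (suc n) = subst (0ℚ ≤_) (sym (ℕtoℚ-suc n)) (0≤a+b 0≤1 (0≤ℕtoℚ n))

ℕtoℚ-mono-≤ : ∀ {m n} → m ℕ.≤ n → ℕtoℚ m ≤ ℕtoℚ n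
ℕtoℚ-mono-≤ {n = n} ℕ.z≤n = 0≤ℕtoℚ n
ℕtoℚ-mono-≤ {suc m} {suc n} (ℕ.s≤s m≤n) =
  subst₂ _≤_ (sym (ℕtoℚ-suc m)) (sym (ℕtoℚ-suc n)) (+-monoʳ-≤ 1ℚ (ℕtoℚ-mono-≤ m≤n))

0≤inv : ∀ n → 0ℚ ≤ inv n
0≤inv zero    = ≤-refl
0≤inv (suc n) = nonNegative⁻¹ (inv (suc n)) {{normalize-nonNeg 1 (suc n)}}

ℕtoℚ-*-inv : ∀ n → ℕtoℚ (suc n) * inv (suc n) ≡ 1ℚ
ℕtoℚ-*-inv n = toℚᵘ-injective (begin
  toℚᵘ (ℕtoℚ (suc n) * inv (suc n))            ≈⟨ toℚᵘ-homo-* (ℕtoℚ (suc n)) (inv (suc n)) ⟩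
  toℚᵘ (ℕtoℚ (suc n)) ℚᵘ.* toℚᵘ (inv (suc n))  ≈⟨ ℚᵘP.*-cong (toℚᵘ-fromℚᵘ (ℚᵘ.mkℚᵘ (ℤ.+ suc n) 0)) (toℚᵘ-fromℚᵘ (ℚᵘ.mkℚᵘ (ℤ.+ 1) n)) ⟩
  ℚᵘ.mkℚᵘ (ℤ.+ suc n) 0 ℚᵘ.* ℚᵘ.mkℚᵘ (ℤ.+ 1) n     ≈⟨ ℚᵘ.*≡* (trans (ℤP.*-identityʳ _) (trans (ℤP.*-identityʳ (ℤ.+ suc n)) (sym (trans (ℤP.*-identityˡ _) (cong ℤ.+_ (ℕP.*-identityˡ (suc n))))))) ⟩
  ℚᵘ.1ℚᵘ                                        ∎)
  where open ℚᵘP.≃-Reasoning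

ℕtoℚ-homo-* : ∀ m n → ℕtoℚ (m ℕ.* n) ≡ ℕtoℚ m * ℕtoℚ n
ℕtoℚ-homo-* zero    n = sym (*-zeroˡ (ℕtoℚ n))
ℕtoℚ-homo-* (suc m) n = begin
  ℕtoℚ (n ℕ.+ m ℕ.* n)          ≡⟨ ℕtoℚ-homo-+ n (m ℕ.* n) ⟩
  ℕtoℚ n + ℕtoℚ (m ℕ.* n)       ≡⟨ cong (ℕtoℚ n +_) (ℕtoℚ-homo-* m n) ⟩
  ℕtoℚ n + ℕtoℚ m * ℕtoℚ n      ≡⟨ solve 2 (λ m n → n :+ m :* n := (con 1ℚ :+ m) :* n) refl (ℕtoℚ m) (ℕtoℚ n) ⟩
  (1ℚ + ℕtoℚ m) * ℕtoℚ n        ≡⟨ cong (_* ℕtoℚ n) (ℕtoℚ-suc m) ⟨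
  ℕtoℚ (suc m) * ℕtoℚ n         ∎
  where
  open ≡-Reasoning
  open +-*-Solver

-- For q = (m+1)/(d+1) the numerator is at least 1, so `d` is a witness.
positive⇒inv≤ : ∀ q → 0ℚ < q → ∃ λ k → inv (suc k) ≤ q
positive⇒inv≤ (mkℚ (ℤ.+ zero) d _) (*<* (ℤ.+<+ ()))
positive⇒inv≤ (mkℚ (ℤ.-[1+ m ]) d _) (*<* ())
positive⇒inv≤ (mkℚ (ℤ.+ suc m) d _) _ = d , toℚᵘ-cancel-≤ (ℚᵘP.≤-trans
  (ℚᵘP.≤-reflexive (toℚᵘ-fromℚᵘ (ℚᵘ.mkℚᵘ (ℤ.+ 1) d)))
  (ℚᵘ.*≤* (ℤP.*-monoʳ-≤-nonNeg (ℤ.+ suc d) (ℤ.+≤+ (s≤s (z≤n {m}))))))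

-- Applied with a = 4 and q = δ, this makes the failure probability 4/n at most δ.
archimedean : ∀ a {q} → 0ℚ < q → ∃ λ N → ∀ {n} → N ℕ.≤ n → ℕtoℚ a ≤ ℕtoℚ n * q
archimedean a {q} 0<q with positive⇒inv≤ q 0<q
... | k , inv≤q = a ℕ.* suc k , λ {n} N≤n → begin
  ℕtoℚ a                             ≡⟨ *-identityʳ (ℕtoℚ a) ⟨
  ℕtoℚ a * 1ℚ                        ≡⟨ cong (ℕtoℚ a *_) (ℕtoℚ-*-inv k) ⟨
  ℕtoℚ a * (ℕtoℚ (suc k) * inv (suc k)) ≡⟨ *-assoc (ℕtoℚ a) (ℕtoℚ (suc k)) (inv (suc k)) ⟨
  ℕtoℚ a * ℕtoℚ (suc k) * inv (suc k) ≡⟨ cong (_* inv (suc k)) (ℕtoℚ-homo-* a (suc k)) ⟨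
  ℕtoℚ (a ℕ.* suc k) * inv (suc k)   ≤⟨ *-mono-≤ (0≤inv (suc k)) (0≤ℕtoℚ n) (ℕtoℚ-mono-≤ N≤n) inv≤q ⟩
  ℕtoℚ n * q                         ∎
  where open ≤-Reasoning

-- Bounding e^x

0≤expTerm : ∀ {x} j → 0ℚ ≤ x → 0ℚ ≤ expTerm x j
0≤expTerm zero    0≤x = 0≤1
0≤expTerm (suc j) 0≤x = 0≤a*b (0≤a*b (0≤expTerm j 0≤x) 0≤x) (0≤inv (suc j))

expTerm-*-index : ∀ x j → expTerm x j * x ≡ expTerm x (suc j) * ℕtoℚ (suc j)
expTerm-*-index x j = sym (begin
  expTerm x j * x * inv (suc j) * ℕtoℚ (suc j)    ≡⟨ *-assoc (expTerm x j * x) (inv (suc j)) _ ⟩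
  expTerm x j * x * (inv (suc j) * ℕtoℚ (suc j))  ≡⟨ cong (expTerm x j * x *_) (trans (*-comm (inv (suc j)) _) (ℕtoℚ-*-inv j)) ⟩
  expTerm x j * x * 1ℚ                            ≡⟨ *-identityʳ _ ⟩
  expTerm x j * x                                 ∎)
  where open ≡-Reasoning

-- The mean value inequality for x^(j+1)/(j+1)!, whose derivative is x^j/j!.
expTerm-increment : ∀ {b y} j → 0ℚ ≤ b → 0ℚ ≤ y →
  expTerm (b + y) (suc j) ≤ expTerm b (suc j) + y * expTerm (b + y) j
expTerm-increment {b} {y} zero 0≤b 0≤y = ≤-reflexive (solve 2 (λ b y →
    con 1ℚ :* (b :+ y) :* con 1ℚ := con 1ℚ :* b :* con 1ℚ :+ y :* con 1ℚ) refl b y)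
  where open +-*-Solver
expTerm-increment {b} {y} (suc j) 0≤b 0≤y = begin
  A₁ * (b + y) * i                          ≡⟨ cong (_* i) (*-distribˡ-+ A₁ b y) ⟩
  (A₁ * b + A₁ * y) * i                     ≤⟨ *-monoˡ-≤ (0≤inv (2 ℕ.+ j)) (+-monoˡ-≤ (A₁ * y) (*-monoˡ-≤ 0≤b (expTerm-increment j 0≤b 0≤y))) ⟩
  -- Adding A₀ y² turns y A₀ b into y A₀ (b + y), to which the recurrence `expTerm-*-index` applies.
  ((B₁ + y * A₀) * b + A₁ * y) * i          ≤⟨ *-monoˡ-≤ (0≤inv (2 ℕ.+ j)) (+-slack⇒≤ {a = (B₁ + y * A₀) * b + A₁ * y} (A₀ * y * y) (0≤a*b (0≤a*b (0≤expTerm j (0≤a+b 0≤b 0≤y)) 0≤y) 0≤y)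
                                               (solve 5 (λ b y a₀ a₁ b₁ → (b₁ :+ y :* a₀) :* b :+ a₁ :* y :+ a₀ :* y :* y
                                                     := b₁ :* b :+ y :* (a₀ :* (b :+ y) :+ a₁)) refl b y A₀ A₁ B₁)) ⟩
  (B₁ * b + y * (A₀ * (b + y) + A₁)) * i    ≡⟨ cong (λ t → (B₁ * b + y * (t + A₁)) * i) (expTerm-*-index (b + y) j) ⟩
  (B₁ * b + y * (A₁ * k + A₁)) * i          ≡⟨ solve 6 (λ b y k a₁ b₁ i → (b₁ :* b :+ y :* (a₁ :* k :+ a₁)) :* i
                                                     := b₁ :* b :* i :+ y :* a₁ :* ((con 1ℚ :+ k) :* i)) refl b y k A₁ B₁ i ⟩
  B₁ * b * i + y * A₁ * ((1ℚ + k) * i)      ≡⟨ cong (λ t → B₁ * b * i + y * A₁ * (t * i)) (ℕtoℚ-suc (suc j)) ⟨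
  B₁ * b * i + y * A₁ * (ℕtoℚ (2 ℕ.+ j) * i) ≡⟨ cong (λ t → B₁ * b * i + y * A₁ * t) (ℕtoℚ-*-inv (suc j)) ⟩
  B₁ * b * i + y * A₁ * 1ℚ                  ≡⟨ cong (λ t → B₁ * b * i + t) (*-identityʳ (y * A₁)) ⟩
  B₁ * b * i + y * A₁                       ∎
  where
  open ≤-Reasoning
  open +-*-Solver
  i  = inv (2 ℕ.+ j)
  k  = ℕtoℚ (suc j)
  A₀ = expTerm (b + y) j
  A₁ = expTerm (b + y) (suc j)
  B₁ = expTerm b (suc j)

expPartial-mono : ∀ {x} k → 0ℚ ≤ x → expPartial x k ≤ expPartial x (suc k)
expPartial-mono k 0≤x = a≤a+b (0≤expTerm k 0≤x)

-- The increments of the single terms add up: the derivative of a partial sum is the partial sum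
-- with one term fewer.
expPartial-increment : ∀ {b y} k → 0ℚ ≤ b → 0ℚ ≤ y →
  expPartial (b + y) (suc k) ≤ expPartial b (suc k) + y * expPartial (b + y) k
expPartial-increment {b} {y} zero 0≤b 0≤y = ≤-reflexive (sym (trans (cong (1ℚ +_) (*-zeroʳ y)) (+-identityʳ _)))
expPartial-increment {b} {y} (suc k) 0≤b 0≤y = ≤-trans
  (+-mono-≤ (expPartial-increment k 0≤b 0≤y) (expTerm-increment k 0≤b 0≤y))
  (≤-reflexive (solve 5 (λ y p q s t → (p :+ y :* q) :+ (s :+ y :* t) := (p :+ s) :+ y :* (q :+ t)) refl
     y (expPartial b (suc k)) (expPartial (b + y) k) (expTerm b (suc k)) (expTerm (b + y) k)))
  where open +-*-Solver

0≤expPartial : ∀ {x} k → 0ℚ ≤ x → 0ℚ ≤ expPartial x k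
0≤expPartial zero 0≤x = ≤-refl
0≤expPartial (suc k) 0≤x = 0≤a+b (0≤expPartial k 0≤x) (0≤expTerm k 0≤x)

-- Truncated form of e^(b+y) ≤ e^b / (1 - y): the increment bound gives P ≤ Q + y P, hence (1 - y) P
-- ≤ Q, and `u` dominates 1 / (1 - y).
expPartial-step : ∀ {b y u} k → 0ℚ ≤ b → 0ℚ ≤ y → 0ℚ ≤ u → 1ℚ ≤ u * (1ℚ - y) →
  expPartial (b + y) (suc k) ≤ u * expPartial b (suc k)
expPartial-step {b} {y} {u} k 0≤b 0≤y 0≤u 1≤u[1-y] = begin
  P                                   ≡⟨ *-identityˡ P ⟨
  1ℚ * P                              ≤⟨ *-monoˡ-≤ (0≤expPartial (suc k) 0≤a) 1≤u[1-y] ⟩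
  u * (1ℚ - y) * P                    ≡⟨ solve 3 (λ u y p → u :* (con 1ℚ :- y) :* p := u :* (p :- y :* p)) refl u y P ⟩
  u * (P - y * P)                     ≤⟨ *-monoʳ-≤ 0≤u (+-monoˡ-≤ (- (y * P)) (≤-trans (expPartial-increment k 0≤b 0≤y)
                                           (+-monoʳ-≤ Q (*-monoʳ-≤ 0≤y (expPartial-mono k 0≤a))))) ⟩
  u * (Q + y * P - y * P)             ≡⟨ solve 3 (λ u q r → u :* (q :+ r :- r) := u :* q) refl u Q (y * P) ⟩
  u * Q                               ∎
  where
  open ≤-Reasoning
  open +-*-Solver
  0≤a = 0≤a+b 0≤b 0≤y
  P = expPartial (b + y) (suc k)
  Q = expPartial b (suc k)

expPartial-0 : ∀ k → expPartial 0ℚ (suc k) ≡ 1ℚ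
expPartial-0 zero = refl
expPartial-0 (suc k) = trans (cong₂ _+_ (expPartial-0 k) (trans (cong (_* inv (suc k)) (*-zeroʳ (expTerm 0ℚ k))) (*-zeroˡ (inv (suc k))))) refl

expPartial-multiple : ∀ {y u} s k → 0ℚ ≤ y → 0ℚ ≤ u → 1ℚ ≤ u * (1ℚ - y) →
  expPartial (ℕtoℚ s * y) (suc k) ≤ u ^ s
expPartial-multiple {y} zero k _ _ _ = ≤-reflexive (trans (cong (λ x → expPartial x (suc k)) (*-zeroˡ y)) (expPartial-0 k))
expPartial-multiple {y} {u} (suc s) k 0≤y 0≤u h = begin
  expPartial (ℕtoℚ (suc s) * y) (suc k)   ≡⟨ cong (λ t → expPartial t (suc k)) (trans (cong (_* y) (ℕtoℚ-suc s))
      (solve 2 (λ m y → (con 1ℚ :+ m) :* y := m :* y :+ y) refl (ℕtoℚ s) y)) ⟩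
  expPartial (ℕtoℚ s * y + y) (suc k)     ≤⟨ expPartial-step k (0≤a*b (0≤ℕtoℚ s) 0≤y) 0≤y 0≤u h ⟩
  u * expPartial (ℕtoℚ s * y) (suc k)     ≤⟨ *-monoʳ-≤ 0≤u (expPartial-multiple s k 0≤y 0≤u h) ⟩
  u ^ suc s                               ∎
  where
  open ≤-Reasoning
  open +-*-Solver

^≤⇒ExpLe : ∀ {y u} s n → 0ℚ ≤ y → 0ℚ ≤ u → 1ℚ ≤ u * (1ℚ - y) → u ^ s ≤ ℕtoℚ n → ExpLe (ℕtoℚ s * y) n
^≤⇒ExpLe s n 0≤y 0≤u h u^s≤n zero    = 0≤ℕtoℚ n
^≤⇒ExpLe s n 0≤y 0≤u h u^s≤n (suc k) = ≤-trans (expPartial-multiple s k 0≤y 0≤u h) u^s≤n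

-- Choice of the constants

inv≤1 : ∀ k → inv (suc k) ≤ 1ℚ
inv≤1 k = subst₂ _≤_ (*-identityˡ (inv (suc k))) (ℕtoℚ-*-inv k)
  (*-monoˡ-≤ (0≤inv (suc k)) (ℕtoℚ-mono-≤ {1} {suc k} (ℕ.s≤s ℕ.z≤n)))

3/5 : ℚ
3/5 = ℤ.+ 3 / 5

0≤3/5 : 0ℚ ≤ 3/5
0≤3/5 = nonNegative⁻¹ 3/5

-- The constant must exceed 1/2 for the bound to hold for small mt, and be below
-- 3/4 for z (1 + a + (constant) a²) ≤ 1 + ε to hold for z ≈ 1 + ε²/4.
[1+t]^m≤quadratic : ∀ {t} m → 0ℚ ≤ t → ℕtoℚ m * t ≤ inv 3 →
  (1ℚ + t) ^ m ≤ 1ℚ + ℕtoℚ m * t + 3/5 * (ℕtoℚ m * t * (ℕtoℚ m * t))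
[1+t]^m≤quadratic {t} zero 0≤t _ = ≤-reflexive (solve 1 (λ t → con 1ℚ :=
    con 1ℚ :+ con 0ℚ :* t :+ con 3/5 :* (con 0ℚ :* t :* (con 0ℚ :* t))) refl t)
  where open +-*-Solver
[1+t]^m≤quadratic {t} (suc m) 0≤t mt≤1/3 = begin
  (1ℚ + t) * (1ℚ + t) ^ m                         ≤⟨ *-monoʳ-≤ (0≤a+b 0≤1 0≤t) ([1+t]^m≤quadratic m 0≤t nt≤1/3) ⟩
  -- With c = 3/5 the slack is t² (n (2c - 1 - c n t) + c). Since 2c - 1 = c/3, the bound n t ≤ 1/3
  -- makes it nonnegative.
  (1ℚ + t) * (1ℚ + n * t + 3/5 * (n * t * (n * t))) ≤⟨ +-slack⇒≤ (t * t * (n * (3/5 * (inv 3 - n * t)) + 3/5))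
        (0≤a*b (0≤a*b 0≤t 0≤t) (0≤a+b (0≤a*b (0≤ℕtoℚ m) (0≤a*b 0≤3/5 (a≤b⇒0≤b-a nt≤1/3))) 0≤3/5))
        (solve 2 (λ n t → (con 1ℚ :+ t) :* (con 1ℚ :+ n :* t :+ con 3/5 :* (n :* t :* (n :* t)))
                             :+ t :* t :* (n :* (con 3/5 :* (con (inv 3) :- n :* t)) :+ con 3/5)
                        := con 1ℚ :+ (con 1ℚ :+ n) :* t :+ con 3/5 :* ((con 1ℚ :+ n) :* t :* ((con 1ℚ :+ n) :* t))) refl n t) ⟩
  1ℚ + (1ℚ + n) * t + 3/5 * ((1ℚ + n) * t * ((1ℚ + n) * t))
      ≡⟨ cong (λ r → 1ℚ + r * t + 3/5 * (r * t * (r * t))) (ℕtoℚ-suc m) ⟨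
  1ℚ + ℕtoℚ (suc m) * t + 3/5 * (ℕtoℚ (suc m) * t * (ℕtoℚ (suc m) * t)) ∎
  where
  open ≤-Reasoning
  open +-*-Solver
  n = ℕtoℚ m
  nt≤1/3 : n * t ≤ inv 3
  nt≤1/3 = ≤-trans (*-monoˡ-≤ 0≤t (ℕtoℚ-mono-≤ (ℕP.n≤1+n m))) mt≤1/3

module Parameters (ε : ℚ) (0<ε : 0ℚ < ε) (ε<1/5 : ε < inv 5) where

  0≤ε : 0ℚ ≤ ε
  0≤ε = <⇒≤ 0<ε

  ε≤1 : ε ≤ 1ℚ
  ε≤1 = ≤-trans (<⇒≤ ε<1/5) (inv≤1 4)

  0≤1-ε : 0ℚ ≤ 1ℚ - ε
  0≤1-ε = a≤b⇒0≤b-a ε≤1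

  1-ε≤1 : 1ℚ - ε ≤ 1ℚ
  1-ε≤1 = +-slack⇒≤ {a = 1ℚ - ε} ε 0≤ε (trans (+-assoc 1ℚ (- ε) ε) (cong (λ t → 1ℚ + t) (+-inverseˡ ε)))

  u : ℚ
  u = 1ℚ + ε * ε * inv 8

  0≤ε² : 0ℚ ≤ ε * ε
  0≤ε² = 0≤a*b 0≤ε 0≤ε

  1≤u : 1ℚ ≤ u
  1≤u = a≤a+b (0≤a*b 0≤ε² (0≤inv 8))

  0≤1-ε² : 0ℚ ≤ 1ℚ - ε * ε
  0≤1-ε² = a≤b⇒0≤b-a (*-mono-≤ 0≤ε 0≤1 ε≤1 ε≤1)

  -- For x = ε², (1 + x/8)(1 - x/9) = 1 + x (1 - x)/72. Thus `u` is at least 1 / (1 - ε²/9), as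
  -- `expPartial-step` requires with y = ε²/9.
  1≤u[1-ε²/9] : 1ℚ ≤ u * (1ℚ - ε * ε * inv 9)
  1≤u[1-ε²/9] = +-slack⇒≤ (inv 72 * (ε * ε * (1ℚ - ε * ε))) (0≤a*b (0≤inv 72) (0≤a*b 0≤ε² 0≤1-ε²))
    (solve 1 (λ e → con 1ℚ :+ con (inv 72) :* (e :* e :* (con 1ℚ :- e :* e))
        := (con 1ℚ :+ e :* e :* con (inv 8)) :* (con 1ℚ :- e :* e :* con (inv 9))) refl ε)
    where open +-*-Solver

  u^≤⇒SizeBound : ∀ s n → u ^ s ≤ ℕtoℚ n → SizeBound ε n s
  u^≤⇒SizeBound s n h = subst (λ x → ExpLe x n)
    (solve 2 (λ s e → s :* (e :* e :* con (inv 9)) := s :* e :* e :* con (inv 9)) refl (ℕtoℚ s) ε)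
    (^≤⇒ExpLe s n (0≤a*b 0≤ε² (0≤inv 9)) (≤-trans 0≤1 1≤u) 1≤u[1-ε²/9] h)
    where open +-*-Solver

  z : ℚ
  z = u * u

  1≤z : 1ℚ ≤ z
  1≤z = *-mono-≤ 0≤1 (≤-trans 0≤1 1≤u) 1≤u 1≤u

  z≤1+ε²/3 : z ≤ 1ℚ + ε * ε * inv 3
  -- With x = ε², z = 1 + x/4 + x²/64 and x/3 - x/4 - x²/64 = x (16/3 - x)/64. Splitting 16/3 as 1 +
  -- 13/3 lets `0≤1-ε²` apply.
  z≤1+ε²/3 = +-slack⇒≤ (inv 64 * (ε * ε * (1ℚ - ε * ε + ℤ.+ 13 / 3)))
    (0≤a*b (0≤inv 64) (0≤a*b 0≤ε² (0≤a+b 0≤1-ε² (nonNegative⁻¹ (ℤ.+ 13 / 3)))))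
    (solve 1 (λ e → (con 1ℚ :+ e :* e :* con (inv 8)) :* (con 1ℚ :+ e :* e :* con (inv 8))
           :+ con (inv 64) :* (e :* e :* (con 1ℚ :- e :* e :+ con (ℤ.+ 13 / 3)))
        := con 1ℚ :+ e :* e :* con (inv 3)) refl ε)
    where open +-*-Solver

  a : ℚ
  a = (1ℚ - ε) * ε

  a≤1/3 : a ≤ inv 3
  a≤1/3 = ≤-trans (*-mono-≤ 0≤ε 0≤1 1-ε≤1 (<⇒≤ ε<1/5)) (toWitness {a? = inv 5 ≤? inv 3} _)

  2/5 : ℚ
  2/5 = ℤ.+ 2 / 5

  -- As a = ε - ε² and a² ≤ ε², the ε² terms amount to at most -1 + 3/5 = -2/5. The slack is 3/5 ε²
  -- (1 - (1 - ε)²).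
  quadratic-bound : 1ℚ + a + 3/5 * (a * a) ≤ 1ℚ + ε - 2/5 * (ε * ε)
  quadratic-bound = +-slack⇒≤ (3/5 * (ε * ε * (ε * (1ℚ + (1ℚ - ε)))))
    (0≤a*b 0≤3/5 (0≤a*b 0≤ε² (0≤a*b 0≤ε (0≤a+b 0≤1 0≤1-ε))))
    (solve 1 (λ e → con 1ℚ :+ (con 1ℚ :- e) :* e :+ con 3/5 :* ((con 1ℚ :- e) :* e :* ((con 1ℚ :- e) :* e))
           :+ con 3/5 :* (e :* e :* (e :* (con 1ℚ :+ (con 1ℚ :- e))))
        := con 1ℚ :+ e :- con 2/5 :* (e :* e)) refl ε)
    where open +-*-Solver

  -- The gain 2/5 ε² outweighs the loss 1/3 ε² by ε²/15, which covers the cubic term ε³/3 when ε ≤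
  -- 1/5. This is the source of ε₀ = 1/5.
  product-bound : (1ℚ + ε * ε * inv 3) * (1ℚ + ε - 2/5 * (ε * ε)) ≤ 1ℚ + ε
  product-bound = +-slack⇒≤ (inv 3 * (ε * ε * (inv 5 - ε)) + ℤ.+ 2 / 15 * (ε * ε * (ε * ε)))
    (0≤a+b (0≤a*b (0≤inv 3) (0≤a*b 0≤ε² (a≤b⇒0≤b-a (<⇒≤ ε<1/5)))) (0≤a*b (nonNegative⁻¹ (ℤ.+ 2 / 15)) (0≤a*b 0≤ε² 0≤ε²)))
    (solve 1 (λ e → (con 1ℚ :+ e :* e :* con (inv 3)) :* (con 1ℚ :+ e :- con 2/5 :* (e :* e))
           :+ (con (inv 3) :* (e :* e :* (con (inv 5) :- e)) :+ con (ℤ.+ 2 / 15) :* (e :* e :* (e :* e)))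
        := con 1ℚ :+ e) refl ε)
    where open +-*-Solver

  -- `k` stands for d - 2, so that `suc k` is d - 1 and `p` is definitionally `pOf ε d`.
  module Degree (k : ℕ) where

    p : ℚ
    p = (1ℚ - ε) * inv (suc k)

    0≤p : 0ℚ ≤ p
    0≤p = 0≤a*b 0≤1-ε (0≤inv (suc k))

    p≤1 : p ≤ 1ℚ
    p≤1 = *-mono-≤ (0≤inv (suc k)) 0≤1 1-ε≤1 (inv≤1 k)

    w : ℚ
    w = 1ℚ + p * ε

    1≤w : 1ℚ ≤ w
    1≤w = a≤a+b (0≤a*b 0≤p 0≤ε)

    w≤2 : w ≤ 1ℚ + 1ℚ
    w≤2 = +-monoʳ-≤ 1ℚ (*-mono-≤ 0≤ε 0≤1 p≤1 ε≤1)

    [d-1]pε≡a : ℕtoℚ (suc k) * (p * ε) ≡ a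
    [d-1]pε≡a = trans
      (solve 4 (λ m q i e → m :* (q :* i :* e) := (m :* i) :* (q :* e)) refl (ℕtoℚ (suc k)) (1ℚ - ε) (inv (suc k)) ε)
      (trans (cong (_* a) (ℕtoℚ-*-inv k)) (*-identityˡ a))
      where open +-*-Solver

    zw^[d-1]≤1+ε : z * w ^ suc k ≤ 1ℚ + ε
    zw^[d-1]≤1+ε = ≤-trans (*-mono-≤ (0≤^ (suc k) (≤-trans 0≤1 1≤w)) (0≤a+b 0≤1 (0≤a*b 0≤ε² (0≤inv 3))) z≤1+ε²/3
      (≤-trans (subst (λ r → w ^ suc k ≤ 1ℚ + r + 3/5 * (r * r)) [d-1]pε≡a
           ([1+t]^m≤quadratic (suc k) (0≤a*b 0≤p 0≤ε) (subst (_≤ inv 3) (sym [d-1]pε≡a) a≤1/3)))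
         quadratic-bound)) product-bound

-- Counting in finite lists

any-true⇒∃ : (P : X → Bool) (xs : List X) → any P xs ≡ true → ∃ λ x → x ∈ xs × P x ≡ true
any-true⇒∃ P (x ∷ xs) h with P x in eq
... | true  = x , here refl , eq
... | false with y , y∈xs , Py ← any-true⇒∃ P xs h = y , there y∈xs , Py

∧-true : ∀ {a b} → a ∧ b ≡ true → a ≡ true × b ≡ true
∧-true {true} {true} _ = refl , refl

∨-true : ∀ {a b} → a ∨ b ≡ true → a ≡ true ⊎ b ≡ true
∨-true {true}  _ = inj₁ refl
∨-true {false} h = inj₂ h

≟-true⇒≡ : ∀ {n} {i j : Fin n} → ⌊ i ≟ j ⌋ ≡ true → i ≡ j
≟-true⇒≡ {i = i} {j} h with yes eq ← i ≟ j = eq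

≟-∧-true : ∀ {n} {a i b j : Fin n} → ⌊ a ≟ i ⌋ ∧ ⌊ b ≟ j ⌋ ≡ true → a ≡ i × b ≡ j
≟-∧-true {a = a} {i} {b} {j} h with ∧-true {⌊ a ≟ i ⌋} {⌊ b ≟ j ⌋} h
... | h₁ , h₂ = ≟-true⇒≡ h₁ , ≟-true⇒≡ h₂

xor-falseˡ : ∀ {a b} → a xor b ≡ false → a ≡ true → b ≡ true
xor-falseˡ {true} {true} _ _ = refl

xor-falseʳ : ∀ {a b} → a xor b ≡ false → b ≡ true → a ≡ true
xor-falseʳ {true} {true} _ _ = refl

≟-refl : ∀ {n} (i : Fin n) → ⌊ i ≟ i ⌋ ≡ true
≟-refl i with i ≟ i
... | yes _ = refl
... | no ¬p = contradiction refl ¬p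

bit : Bool → ℕ
bit b = if b then 1 else 0

bit-mono : ∀ {a b} → (a ≡ true → b ≡ true) → bit a ℕ.≤ bit b
bit-mono {false} _ = z≤n
bit-mono {true} {b} h rewrite h refl = s≤s z≤n

Σ[_]_ : List X → (X → ℕ) → ℕ
Σ[ xs ] f = sum (map f xs)

count : (X → Bool) → List X → ℕ
count P xs = Σ[ xs ] (bit ∘ P)

countTrue≡count : (P : X → Bool) (xs : List X) → countTrue (map P xs) ≡ count P xs
countTrue≡count P [] = refl
countTrue≡count P (x ∷ xs) with P x
... | true  = cong suc (countTrue≡count P xs)
... | false = countTrue≡count P xs

Σ-mono : {f g : X → ℕ} (xs : List X) → (∀ x → f x ℕ.≤ g x) → Σ[ xs ] f ℕ.≤ Σ[ xs ] g
Σ-mono [] _ = z≤n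
Σ-mono (x ∷ xs) f≤g = ℕP.+-mono-≤ (f≤g x) (Σ-mono xs f≤g)

Σ-distrib-+ : (f g : X → ℕ) (xs : List X) → Σ[ xs ] (λ x → f x ℕ.+ g x) ≡ Σ[ xs ] f ℕ.+ Σ[ xs ] g
Σ-distrib-+ f g [] = refl
Σ-distrib-+ f g (x ∷ xs) = trans (cong (f x ℕ.+ g x ℕ.+_) (Σ-distrib-+ f g xs)) (ℕ-+-interchange (f x) (g x) (Σ[ xs ] f) (Σ[ xs ] g))

Σ-concatMap : (f : Y → ℕ) (h : X → List Y) (xs : List X) →
  Σ[ concatMap h xs ] f ≡ Σ[ xs ] (λ x → Σ[ h x ] f)
Σ-concatMap f h [] = refl
Σ-concatMap f h (x ∷ xs) = begin
  sum (map f (h x ++ concatMap h xs))             ≡⟨ cong sum (map-++ f (h x) _) ⟩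
  sum (map f (h x) ++ map f (concatMap h xs))     ≡⟨ sum-++ (map f (h x)) _ ⟩
  Σ[ h x ] f ℕ.+ Σ[ concatMap h xs ] f              ≡⟨ cong (Σ[ h x ] f ℕ.+_) (Σ-concatMap f h xs) ⟩
  Σ[ h x ] f ℕ.+ Σ[ xs ] (λ x → Σ[ h x ] f)         ∎
  where open ≡-Reasoning

Σ-0 : (xs : List X) → Σ[ xs ] (λ _ → 0) ≡ 0
Σ-0 [] = refl
Σ-0 (_ ∷ xs) = Σ-0 xs

Σ-if : (c : Bool) (f : X → ℕ) (xs : List X) →
  Σ[ xs ] (λ x → if c then f x else 0) ≡ (if c then Σ[ xs ] f else 0)
Σ-if true  f xs = refl
Σ-if false f xs = Σ-0 xs

module _ {n : ℕ} (c : Fin n) (f : Fin n → ℕ) where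

  Σ-δ-absent : ∀ {xs} → All (c ≢_) xs → Σ[ xs ] (λ i → if ⌊ c ≟ i ⌋ then f i else 0) ≡ 0
  Σ-δ-absent [] = refl
  Σ-δ-absent {i ∷ _} (c≢i ∷ c∉xs) with c ≟ i
  ... | yes c≡i = contradiction c≡i c≢i
  ... | no _    = Σ-δ-absent c∉xs

  -- By uniqueness at most one summand survives; if `c` is absent none does, hence an inequality.
  Σ-δ : ∀ {xs} → Unique xs → Σ[ xs ] (λ i → if ⌊ c ≟ i ⌋ then f i else 0) ℕ.≤ f c
  Σ-δ [] = z≤n
  Σ-δ {i ∷ xs} (i∉xs ∷ xs!) with c ≟ i
  ... | yes refl = ℕP.≤-reflexive (trans (cong (f c ℕ.+_) (Σ-δ-absent i∉xs)) (ℕP.+-identityʳ (f c)))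
  ... | no _     = Σ-δ xs!

-- Degrees

touches : ∀ {n} → Fin n → Edge n → Bool
touches c (i , j) = ⌊ c ≟ i ⌋ ∨ ⌊ c ≟ j ⌋

module _ {n : ℕ} (G : Graph n) where

  private
    V : List (Fin n)
    V = allFin n

    edge : Fin n → Fin n → Bool
    edge i j = adj G i j ∧ (toℕ i <ᵇ toℕ j)

    count-cell : ∀ c i j → count (touches c) (if edge i j then (i , j) ∷ [] else [])
      ℕ.≤ (if ⌊ c ≟ i ⌋ then bit (edge i j) else 0) ℕ.+ (if ⌊ c ≟ j ⌋ then bit (edge i j) else 0)
    count-cell c i j with edge i j
    ... | false = z≤n
    ... | true with ⌊ c ≟ i ⌋ | ⌊ c ≟ j ⌋
    ...   | true  | true  = s≤s z≤n
    ...   | true  | false = s≤s z≤n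
    ...   | false | true  = s≤s z≤n
    ...   | false | false = z≤n

    <ᵇ-asym : ∀ m n → (m <ᵇ n) ≡ true → (n <ᵇ m) ≡ false
    <ᵇ-asym zero    (suc n) _ = refl
    <ᵇ-asym (suc m) (suc n) h = <ᵇ-asym m n h

    -- `edges` lists each edge with its smaller endpoint first, so only one of the two orientations
    -- can occur.
    edge-exclusive : ∀ c j → bit (edge c j) ℕ.+ bit (edge j c) ℕ.≤ bit (adj G c j)
    edge-exclusive c j rewrite adj-sym G j c with adj G c j
    ... | false = z≤n
    ... | true with toℕ c <ᵇ toℕ j in eq
    ...   | true rewrite <ᵇ-asym (toℕ c) (toℕ j) eq = s≤s z≤n
    ...   | false with toℕ j <ᵇ toℕ c
    ...     | true  = s≤s z≤n
    ...     | false = z≤n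

  -- The listed edges at `c` fill row `c` and column `c` of the matrix `edge`. Pairing entry (c, j)
  -- with entry (j, c) leaves at most one edge per neighbour j.
  count-touches-edges≤degree : ∀ c → count (touches c) (edges G) ℕ.≤ degree G c
  count-touches-edges≤degree c = begin
    count (touches c) (edges G)
      ≡⟨ Σ-concatMap _ _ V ⟩
    (Σ[ V ] λ i → count (touches c) (concatMap (λ j → if edge i j then (i , j) ∷ [] else []) V))
      ≤⟨ Σ-mono V row ⟩
    (Σ[ V ] λ i → (if ⌊ c ≟ i ⌋ then count (edge i) V else 0) ℕ.+ bit (edge i c))
      ≡⟨ Σ-distrib-+ _ _ V ⟩
    (Σ[ V ] λ i → if ⌊ c ≟ i ⌋ then count (edge i) V else 0) ℕ.+ (Σ[ V ] λ i → bit (edge i c))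
      ≤⟨ ℕP.+-monoˡ-≤ _ (Σ-δ c (λ i → count (edge i) V) (allFin⁺ n)) ⟩
    count (edge c) V ℕ.+ (Σ[ V ] λ i → bit (edge i c))
      ≡⟨ Σ-distrib-+ _ _ V ⟨
    (Σ[ V ] λ j → bit (edge c j) ℕ.+ bit (edge j c))
      ≤⟨ Σ-mono V (edge-exclusive c) ⟩
    count (adj G c) V
      ≡⟨ countTrue≡count (adj G c) V ⟨
    degree G c ∎
    where
    open ℕP.≤-Reasoning
    -- Row i counts in full when i = c; apart from that, only its entry in column `c` can touch `c`.
    row : ∀ i → count (touches c) (concatMap (λ j → if edge i j then (i , j) ∷ [] else []) V)
      ℕ.≤ (if ⌊ c ≟ i ⌋ then count (edge i) V else 0) ℕ.+ bit (edge i c)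
    row i = begin
      count (touches c) (concatMap (λ j → if edge i j then (i , j) ∷ [] else []) V)
        ≡⟨ Σ-concatMap _ _ V ⟩
      (Σ[ V ] λ j → count (touches c) (if edge i j then (i , j) ∷ [] else []))
        ≤⟨ Σ-mono V (count-cell c i) ⟩
      (Σ[ V ] λ j → (if ⌊ c ≟ i ⌋ then bit (edge i j) else 0) ℕ.+ (if ⌊ c ≟ j ⌋ then bit (edge i j) else 0))
        ≡⟨ Σ-distrib-+ _ _ V ⟩
      (Σ[ V ] λ j → if ⌊ c ≟ i ⌋ then bit (edge i j) else 0) ℕ.+ (Σ[ V ] λ j → if ⌊ c ≟ j ⌋ then bit (edge i j) else 0)
        ≤⟨ ℕP.+-mono-≤ (ℕP.≤-reflexive (Σ-if ⌊ c ≟ i ⌋ _ V)) (Σ-δ c _ (allFin⁺ n)) ⟩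
      (if ⌊ c ≟ i ⌋ then count (edge i) V else 0) ℕ.+ bit (edge i c) ∎

  degree≤maxDegree : ∀ c → degree G c ℕ.≤ maxDegree G
  degree≤maxDegree c = bound V (∈-allFin c)
    where
    bound : ∀ xs → c ∈ xs → degree G c ℕ.≤ foldr _⊔_ 0 (map (degree G) xs)
    bound (x ∷ xs) (here refl)  = ℕP.m≤m⊔n _ _
    bound (x ∷ xs) (there c∈xs) = ℕP.≤-trans (bound xs c∈xs) (ℕP.m≤n⊔m (degree G x) _)

-- Vertex sets and their boundary edges

boundary : ∀ {n} → (Fin n → Bool) → Edge n → Bool
boundary A (i , j) = A i xor A j

Inside : ∀ {n} → (Fin n → Bool) → Edge n → Set
Inside A (i , j) = A i ≡ true × A j ≡ true

insert : ∀ {n} → Fin n → (Fin n → Bool) → Fin n → Bool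
insert c A i = A i ∨ ⌊ c ≟ i ⌋

module _ {n : ℕ} where

  inside⇒¬boundary : ∀ (A : Fin n → Bool) e → Inside A e → boundary A e ≡ false
  inside⇒¬boundary A e (Ai , Aj) rewrite Ai | Aj = refl

  count-insert : ∀ c (A : Fin n → Bool) → count (insert c A) (allFin n) ℕ.≤ suc (count A (allFin n))
  count-insert c A = begin
    count (insert c A) (allFin n)                                       ≤⟨ Σ-mono (allFin n) pointwise ⟩
    (Σ[ allFin n ] λ i → bit (A i) ℕ.+ (if ⌊ c ≟ i ⌋ then 1 else 0))      ≡⟨ Σ-distrib-+ _ _ (allFin n) ⟩
    count A (allFin n) ℕ.+ (Σ[ allFin n ] λ i → if ⌊ c ≟ i ⌋ then 1 else 0) ≤⟨ ℕP.+-monoʳ-≤ (count A (allFin n)) (Σ-δ c (λ _ → 1) (allFin⁺ n)) ⟩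
    count A (allFin n) ℕ.+ 1                                              ≡⟨ ℕP.+-comm _ 1 ⟩
    suc (count A (allFin n))                                            ∎
    where
    open ℕP.≤-Reasoning
    pointwise : ∀ i → bit (insert c A i) ℕ.≤ bit (A i) ℕ.+ (if ⌊ c ≟ i ⌋ then 1 else 0)
    pointwise i with A i
    ... | true  = s≤s z≤n
    ... | false = ℕP.≤-refl

  -- Membership changes only at `c`, so an edge that becomes a boundary edge touches `c`.
  count-boundary-insert : ∀ c (A : Fin n → Bool) es →
    count (boundary (insert c A)) es ℕ.≤ count (boundary A) es ℕ.+ count (touches c) es
  count-boundary-insert c A es = ℕP.≤-trans (Σ-mono es pointwise) (ℕP.≤-reflexive (Σ-distrib-+ _ _ es))
    where
    pointwise : ∀ e → bit (boundary (insert c A) e) ℕ.≤ bit (boundary A e) ℕ.+ bit (touches c e)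
    pointwise (i , j) with A i | A j | ⌊ c ≟ i ⌋ | ⌊ c ≟ j ⌋
    ... | false | false | false | false = z≤n
    ... | false | false | false | true  = s≤s z≤n
    ... | false | false | true  | false = s≤s z≤n
    ... | false | false | true  | true  = z≤n
    ... | false | true  | false | _     = s≤s z≤n
    ... | false | true  | true  | _     = z≤n
    ... | true  | false | _     | false = s≤s z≤n
    ... | true  | false | _     | true  = z≤n
    ... | true  | true  | _     | _     = z≤n

  inside-insert : ∀ c (A : Fin n → Bool) e → Inside A e → Inside (insert c A) e
  inside-insert c A e (Ai , Aj) rewrite Ai | Aj = refl , refl

  -- The witness is the endpoint not yet in `A`.
  boundary⇒new-vertex : ∀ (A : Fin n → Bool) e → boundary A e ≡ true →
    ∃ λ c → touches c e ≡ true × Inside (insert c A) e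
  boundary⇒new-vertex A (i , j) h with A i | A j
  ... | true  | false = j , touch , (refl , ≟-refl j)
    where
    touch : touches j (i , j) ≡ true
    touch rewrite ≟-refl j with ⌊ j ≟ i ⌋
    ... | true  = refl
    ... | false = refl
  ... | false | true  = i , cong (_∨ ⌊ i ≟ j ⌋) (≟-refl i) , (≟-refl i , refl)

  module _ {A : Fin n → Bool} {S : List (Edge n)} (closed : All (λ e → boundary A e ≡ false) S) where

    adjS-closed : ∀ {i j} → A i ≡ true → adjS S i j ≡ true → A j ≡ true
    adjS-closed {i} {j} Ai h with any-true⇒∃ _ S h
    ... | (a , b) , ab∈S , h′ with ∨-true h′
    ...   | inj₁ h₁ with refl , refl ← ≟-∧-true {a = a} {i} {b} {j} h₁ = xor-falseˡ (All.lookup closed ab∈S) Ai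
    ...   | inj₂ h₂ with refl , refl ← ≟-∧-true {a = a} {j} {b} {i} h₂ = xor-falseʳ (All.lookup closed ab∈S) Ai

    reach-closed : ∀ {v} → A v ≡ true → ∀ k {i} → reach S k v i ≡ true → A i ≡ true
    reach-closed Av zero h = subst (λ i → A i ≡ true) (≟-true⇒≡ h) Av
    reach-closed {v} Av (suc k) {i} h with ∨-true {reach S k v i} h
    ... | inj₁ h₁ = reach-closed Av k h₁
    ... | inj₂ h₂ with w , _ , h₃ ← any-true⇒∃ _ (allFin n) h₂ =
      adjS-closed (reach-closed Av k (proj₁ (∧-true h₃))) (proj₂ (∧-true {reach S k v w} h₃))

    -- No retained edge leaves `A`, so no path from `v` does, and the whole component lies in `A`.
    componentSize≤count : ∀ {v} → A v ≡ true → componentSize S v ℕ.≤ count A (allFin n)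
    componentSize≤count {v} Av = subst (ℕ._≤ count A (allFin n)) (sym (countTrue≡count (reach S n v) (allFin n)))
      (Σ-mono (allFin n) (λ i → bit-mono (reach-closed Av n)))

  count-boundary-singleton : ∀ v (es : List (Edge n)) →
    count (boundary (λ i → ⌊ v ≟ i ⌋)) es ℕ.≤ count (touches v) es
  count-boundary-singleton v es = Σ-mono es pointwise
    where
    pointwise : ∀ e → bit (boundary (λ i → ⌊ v ≟ i ⌋) e) ℕ.≤ bit (touches v e)
    pointwise (i , j) with ⌊ v ≟ i ⌋ | ⌊ v ≟ j ⌋
    ... | true  | true  = z≤n
    ... | true  | false = s≤s z≤n
    ... | false | _     = ℕP.≤-refl

-- Invariance under reordering the edges

any-↭ : (P : X → Bool) {xs ys : List X} → xs ↭ ys → any P xs ≡ any P ys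
any-↭ P ↭.refl = refl
any-↭ P (prep x h) = cong (P x ∨_) (any-↭ P h)
any-↭ P (swap x y h) rewrite any-↭ P h with P x | P y
... | true  | true  = refl
... | true  | false = refl
... | false | true  = refl
... | false | false = refl
any-↭ P (↭.trans h₁ h₂) = trans (any-↭ P h₁) (any-↭ P h₂)

module _ {n : ℕ} {S T : List (Edge n)} (S↭T : S ↭ T) where

  reach-↭ : ∀ k v i → reach S k v i ≡ reach T k v i
  reach-↭ zero    v i = refl
  reach-↭ (suc k) v i = cong₂ _∨_ (reach-↭ k v i)
    (cong or (map-cong (λ w → cong₂ _∧_ (reach-↭ k v w) (any-↭ _ S↭T)) (allFin n)))

  componentSize-↭ : ∀ v → componentSize S v ≡ componentSize T v
  componentSize-↭ v = cong countTrue (map-cong (reach-↭ n v) (allFin n))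

count-↭ : (P : X → Bool) {xs ys : List X} → xs ↭ ys → count P xs ≡ count P ys
count-↭ P h = sum-↭ (map⁺ _ h)

-- Decides the next move of the exploration: stop, or reveal the edge at which the list is split.
find-true : (P : X → Bool) (xs : List X) → All (λ x → P x ≡ false) xs ⊎
  (∃ λ x → ∃ λ ys → ∃ λ zs → P x ≡ true × xs ≡ ys ++ x ∷ zs)
find-true P [] = inj₁ []
find-true P (x ∷ xs) with P x in Px
... | true  = inj₂ (x , [] , xs , Px , refl)
... | false with find-true P xs
...   | inj₁ none = inj₁ (Px ∷ none)
...   | inj₂ (y , ys , zs , Py , eq) = inj₂ (y , x ∷ ys , zs , Py , cong (x ∷_) eq)

-- Expectations

module _ {p : ℚ} {f : List X → ℚ} (f-↭ : ∀ {S T} → S ↭ T → f S ≡ f T) where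

  expect-acc-↭ : ∀ {acc acc′} es → acc ↭ acc′ → expect p f acc es ≡ expect p f acc′ es
  expect-acc-↭ [] h = f-↭ h
  expect-acc-↭ (e ∷ es) h = cong₂ (λ x y → p * x + (1ℚ - p) * y) (expect-acc-↭ es (↭-prep e h)) (expect-acc-↭ es h)

  -- The exploration picks its next edge from the middle of the list. Two independent choices
  -- commute and `f` ignores the order of the accumulated edges, so the picked edge can be moved to
  -- the front.
  expect-reveal : ∀ acc xs e ys → expect p f acc (xs ++ e ∷ ys) ≡ expect p f acc (e ∷ xs ++ ys)
  expect-reveal acc [] e ys = refl
  expect-reveal acc (x ∷ xs) e ys = begin
    p * expect p f (x ∷ acc) (xs ++ e ∷ ys) + (1ℚ - p) * expect p f acc (xs ++ e ∷ ys)
      ≡⟨ cong₂ (λ x y → p * x + (1ℚ - p) * y) (expect-reveal (x ∷ acc) xs e ys) (expect-reveal acc xs e ys) ⟩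
    p * (p * expect p f (e ∷ x ∷ acc) R + (1ℚ - p) * Ex) + (1ℚ - p) * (p * Ee + (1ℚ - p) * E)
      ≡⟨ cong (λ t → p * (p * t + (1ℚ - p) * Ex) + (1ℚ - p) * (p * Ee + (1ℚ - p) * E)) (expect-acc-↭ R (↭-swap e x ↭-refl)) ⟩
    p * (p * Exe + (1ℚ - p) * Ex) + (1ℚ - p) * (p * Ee + (1ℚ - p) * E)
      ≡⟨ solve 6 (λ p q a b c d → p :* (p :* a :+ q :* b) :+ q :* (p :* c :+ q :* d)
                              := p :* (p :* a :+ q :* c) :+ q :* (p :* b :+ q :* d)) refl p (1ℚ - p) Exe Ex Ee E ⟩
    p * (p * Exe + (1ℚ - p) * Ee) + (1ℚ - p) * (p * Ex + (1ℚ - p) * E) ∎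
    where
    open ≡-Reasoning
    open +-*-Solver
    R   = xs ++ ys
    Exe = expect p f (x ∷ e ∷ acc) R
    Ex  = expect p f (x ∷ acc) R
    Ee  = expect p f (e ∷ acc) R
    E   = expect p f acc R

module _ {p : ℚ} (0≤p : 0ℚ ≤ p) (p≤1 : p ≤ 1ℚ) where

  private
    0≤1-p : 0ℚ ≤ 1ℚ - p
    0≤1-p = a≤b⇒0≤b-a p≤1

    average-≤ : ∀ {a b c d} → a ≤ c → b ≤ d → p * a + (1ℚ - p) * b ≤ p * c + (1ℚ - p) * d
    average-≤ a≤c b≤d = +-mono-≤ (*-monoʳ-≤ 0≤p a≤c) (*-monoʳ-≤ 0≤1-p b≤d)

  -- Every outcome consists of edges from `acc` and `es`, so `f` has to be bounded only on lists
  -- with all entries in `Q`.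
  expect-≤-All : ∀ {Q : X → Set} {f : List X → ℚ} {M} → (∀ {S} → All Q S → f S ≤ M) →
    ∀ {acc es} → All Q acc → All Q es → expect p f acc es ≤ M
  expect-≤-All f≤M Qacc [] = f≤M Qacc
  expect-≤-All {M = M} f≤M Qacc (Qe ∷ Qes) = ≤-trans
    (average-≤ (expect-≤-All f≤M (Qe ∷ Qacc) Qes) (expect-≤-All f≤M Qacc Qes))
    (≤-reflexive (solve 2 (λ p m → p :* m :+ (con 1ℚ :- p) :* m := m) refl p M))
    where open +-*-Solver

  -- Monotonicity and linearity of expectation in one induction, in the shape the union bound needs:
  -- there `c` is n² and `h` is the weight from Markov's inequality.
  expect-≤-linear : ∀ c {f g h : List X → ℚ} → (∀ S → c * f S ≤ c * g S + h S) →
    ∀ acc es → c * expect p f acc es ≤ c * expect p g acc es + expect p h acc es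
  expect-≤-linear c ineq acc [] = ineq acc
  expect-≤-linear c {f} {g} {h} ineq acc (e ∷ es) = begin
    c * (p * F₁ + (1ℚ - p) * F₀)
      ≡⟨ solve 4 (λ c p a b → c :* (p :* a :+ (con 1ℚ :- p) :* b) := p :* (c :* a) :+ (con 1ℚ :- p) :* (c :* b)) refl c p F₁ F₀ ⟩
    p * (c * F₁) + (1ℚ - p) * (c * F₀)
      ≤⟨ average-≤ (expect-≤-linear c ineq (e ∷ acc) es) (expect-≤-linear c ineq acc es) ⟩
    p * (c * G₁ + H₁) + (1ℚ - p) * (c * G₀ + H₀)
      ≡⟨ solve 6 (λ c p a b d e → p :* (c :* a :+ d) :+ (con 1ℚ :- p) :* (c :* b :+ e)
            := c :* (p :* a :+ (con 1ℚ :- p) :* b) :+ (p :* d :+ (con 1ℚ :- p) :* e)) refl c p G₁ G₀ H₁ H₀ ⟩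
    c * (p * G₁ + (1ℚ - p) * G₀) + (p * H₁ + (1ℚ - p) * H₀) ∎
    where
    open ≤-Reasoning
    open +-*-Solver
    F₁ = expect p f (e ∷ acc) es
    F₀ = expect p f acc es
    G₁ = expect p g (e ∷ acc) es
    G₀ = expect p g acc es
    H₁ = expect p h (e ∷ acc) es
    H₀ = expect p h acc es

  -- A is the set of vertices found so far, acc the retained edges that have been
  -- revealed, L the unrevealed edges.
  module Exploration {ε z : ℚ} {D : ℕ} (1≤z : 1ℚ ≤ z) (0≤ε : 0ℚ ≤ ε)
    (zw^D≤1+ε : z * (1ℚ + p * ε) ^ D ≤ 1ℚ + ε) {n : ℕ} (v : Fin n) where

    w : ℚ
    w = 1ℚ + p * ε

    weight : List (Edge n) → ℚ
    weight S = z ^ componentSize S v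

    ∣_∣ᵥ : (Fin n → Bool) → ℕ
    ∣ A ∣ᵥ = count A (allFin n)

    private
      1≤w : 1ℚ ≤ w
      1≤w = a≤a+b (0≤a*b 0≤p 0≤ε)

      0≤z : 0ℚ ≤ z
      0≤z = ≤-trans 0≤1 1≤z

      0≤w : 0ℚ ≤ w
      0≤w = ≤-trans 0≤1 1≤w

      -- `w` is fixed by p (1 + ε) + (1 - p) = w: since z w^D ≤ 1 + ε, the one factor `w` attached
      -- to the revealed edge pays for both outcomes.
      reveal-bound : ∀ s m → p * (z ^ suc s * w ^ (m ℕ.+ D)) + (1ℚ - p) * (z ^ s * w ^ m) ≤ z ^ s * w ^ suc m
      reveal-bound s m = begin
        p * (z * z ^ s * w ^ (m ℕ.+ D)) + (1ℚ - p) * (z ^ s * w ^ m)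
          ≡⟨ cong (λ t → p * (z * z ^ s * t) + (1ℚ - p) * (z ^ s * w ^ m)) (^-homo-* w m D) ⟩
        p * (z * z ^ s * (w ^ m * w ^ D)) + (1ℚ - p) * (z ^ s * w ^ m)
          ≡⟨ solve 5 (λ p z a b c → p :* (z :* a :* (b :* c)) :+ (con 1ℚ :- p) :* (a :* b)
                 := a :* b :* (p :* (z :* c) :+ (con 1ℚ :- p))) refl p z (z ^ s) (w ^ m) (w ^ D) ⟩
        z ^ s * w ^ m * (p * (z * w ^ D) + (1ℚ - p))
          ≤⟨ *-monoʳ-≤ (0≤a*b (0≤^ s 0≤z) (0≤^ m 0≤w)) (+-monoˡ-≤ (1ℚ - p) (*-monoʳ-≤ 0≤p zw^D≤1+ε)) ⟩
        z ^ s * w ^ m * (p * (1ℚ + ε) + (1ℚ - p))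
          ≡⟨ solve 4 (λ p e a b → a :* b :* (p :* (con 1ℚ :+ e) :+ (con 1ℚ :- p))
                 := a :* ((con 1ℚ :+ p :* e) :* b)) refl p ε (z ^ s) (w ^ m) ⟩
        z ^ s * (w * w ^ m) ∎
        where
        open ≤-Reasoning
        open +-*-Solver

    -- Induction on the number `k` of unrevealed edges, kept as an argument because deleting an edge
    -- from the middle of `L` yields no structural subterm. The edges of `acc` lie inside `A`, so
    -- only unrevealed ones can leave it.
    weight-bound : ∀ k L → length L ≡ k → ∀ A acc → A v ≡ true → All (Inside A) acc →
      (∀ c → count (touches c) L ℕ.≤ suc D) →
      expect p weight acc L ≤ z ^ ∣ A ∣ᵥ * w ^ count (boundary A) L
    weight-bound k L len A acc Av inside deg with find-true (boundary A) L
    -- With no boundary edge left, the component of `v` stays inside `A` however the remaining edges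
    -- turn out.
    ... | inj₁ none = begin
      expect p weight acc L              ≤⟨ expect-≤-All {Q = λ e → boundary A e ≡ false} (λ closed → ^-monoʳ-≤ 1≤z (componentSize≤count {A = A} closed Av))
                                              (All.map (λ {e} → inside⇒¬boundary A e) inside) none ⟩
      z ^ ∣ A ∣ᵥ                         ≡⟨ *-identityʳ _ ⟨
      z ^ ∣ A ∣ᵥ * 1ℚ                    ≤⟨ *-monoʳ-≤ (0≤^ ∣ A ∣ᵥ 0≤z) (1≤^ (count (boundary A) L) 1≤w) ⟩
      z ^ ∣ A ∣ᵥ * w ^ count (boundary A) L ∎
      where open ≤-Reasoning
    weight-bound zero _ len A acc Av inside deg | inj₂ (e , xs , ys , Be , refl) with () ← trans (sym (↭-length (shift e xs ys))) len
    weight-bound (suc k) _ len A acc Av inside deg | inj₂ (e , xs , ys , Be , refl) with boundary⇒new-vertex A e Be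
    ... | c , ce , e-inside = begin
      expect p weight acc (xs ++ e ∷ ys)
        ≡⟨ expect-reveal (λ S↭T → cong (z ^_) (componentSize-↭ S↭T v)) acc xs e ys ⟩
      p * expect p weight (e ∷ acc) R + (1ℚ - p) * expect p weight acc R
        -- Edge retained: `c` joins `A` and brings at most `D` new boundary edges.
        ≤⟨ average-≤ (≤-trans (weight-bound k R lenR (insert c A) (e ∷ acc) (cong (_∨ ⌊ c ≟ v ⌋) Av)
                                (e-inside ∷ All.map (λ {e} → inside-insert c A e) inside) degR)
                        (*-mono-≤ (0≤^ (count (boundary (insert c A)) R) 0≤w) (0≤^ (suc ∣ A ∣ᵥ) 0≤z)
                           (^-monoʳ-≤ 1≤z (count-insert c A)) (^-monoʳ-≤ 1≤w boundary′)))
                     -- Edge discarded: `A` stays and there is one boundary edge fewer.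
                     (weight-bound k R lenR A acc Av inside degR) ⟩
      p * (z ^ suc ∣ A ∣ᵥ * w ^ (m ℕ.+ D)) + (1ℚ - p) * (z ^ ∣ A ∣ᵥ * w ^ m)
        ≤⟨ reveal-bound ∣ A ∣ᵥ m ⟩
      z ^ ∣ A ∣ᵥ * w ^ suc m
        ≡⟨ cong (λ t → z ^ ∣ A ∣ᵥ * w ^ t) (count-e (boundary A) Be) ⟨
      z ^ ∣ A ∣ᵥ * w ^ count (boundary A) (xs ++ e ∷ ys) ∎
      where
      open ≤-Reasoning
      R = xs ++ ys
      m = count (boundary A) R
      lenR : length R ≡ k
      lenR = ℕP.suc-injective (trans (sym (↭-length (shift e xs ys))) len)
      count-e : (P : Edge n → Bool) → P e ≡ true → count P (xs ++ e ∷ ys) ≡ suc (count P R)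
      count-e P Pe = trans (count-↭ P (shift e xs ys)) (cong (λ b → bit b ℕ.+ count P R) Pe)
      degR : ∀ c → count (touches c) R ℕ.≤ suc D
      degR c′ = ℕP.≤-trans (ℕP.m≤n+m _ _) (ℕP.≤-trans (ℕP.≤-reflexive (sym (count-↭ (touches c′) (shift e xs ys)))) (deg c′))
      -- The revealed edge `e` is itself one of the at most D + 1 edges at `c`, so at most `D` of
      -- them remain in `R`.
      boundary′ : count (boundary (insert c A)) R ℕ.≤ m ℕ.+ D
      boundary′ = ℕP.≤-trans (count-boundary-insert c A R) (ℕP.+-monoʳ-≤ m
        (ℕP.≤-pred (ℕP.≤-trans (ℕP.≤-reflexive (sym (count-e (touches c) ce))) (deg c))))

    -- The exploration starts from A = {v}. All of the up to D + 1 edges at `v` are still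
    -- unrevealed, one more than a later vertex brings, hence the extra factor `w` beside z w^D ≤ 1
    -- + ε.
    expect-weight : ∀ L → (∀ c → count (touches c) L ℕ.≤ suc D) → expect p weight [] L ≤ w * (1ℚ + ε)
    expect-weight L deg = begin
      expect p weight [] L                     ≤⟨ weight-bound (length L) L refl ⁅v⁆ [] (≟-refl v) [] deg ⟩
      z ^ ∣ ⁅v⁆ ∣ᵥ * w ^ count (boundary ⁅v⁆) L  ≤⟨ *-mono-≤ (0≤^ (count (boundary ⁅v⁆) L) 0≤w) (0≤^ 1 0≤z)
                                                   (^-monoʳ-≤ {m = ∣ ⁅v⁆ ∣ᵥ} 1≤z (Σ-δ v (λ _ → 1) (allFin⁺ n)))
                                                   (^-monoʳ-≤ 1≤w (ℕP.≤-trans (count-boundary-singleton v L) (deg v))) ⟩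
      z * 1ℚ * (w * w ^ D)                     ≡⟨ solve 3 (λ z w t → z :* con 1ℚ :* (w :* t) := w :* (z :* t)) refl z w (w ^ D) ⟩
      w * (z * w ^ D)                          ≤⟨ *-monoʳ-≤ 0≤w zw^D≤1+ε ⟩
      w * (1ℚ + ε)                             ∎
      where
      open ≤-Reasoning
      open +-*-Solver
      ⁅v⁆ : Fin n → Bool
      ⁅v⁆ i = ⌊ v ≟ i ⌋

-- Markov's inequality and the union bound

indicator : Bool → ℚ
indicator b = if b then 1ℚ else 0ℚ

all-true⇒ : ∀ {X : Set} (P : X → Bool) {xs x} → all P xs ≡ true → x ∈ xs → P x ≡ true
all-true⇒ P h (here refl)  = proj₁ (∧-true h)
all-true⇒ P {y ∷ _} h (there x∈xs) = all-true⇒ P (proj₂ (∧-true {P y} h)) x∈xs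

expect-1 : ∀ {X : Set} p acc (es : List X) → expect p (λ _ → 1ℚ) acc es ≡ 1ℚ
expect-1 p acc [] = refl
expect-1 p acc (e ∷ es) = trans (cong₂ (λ x y → p * x + (1ℚ - p) * y) (expect-1 p (e ∷ acc) es) (expect-1 p acc es))
  (solve 1 (λ p → p :* con 1ℚ :+ (con 1ℚ :- p) :* con 1ℚ := con 1ℚ) refl p)
  where open +-*-Solver

module UnionBound {n : ℕ} (G : Graph n) {p u M : ℚ} (0≤p : 0ℚ ≤ p) (p≤1 : p ≤ 1ℚ) (0≤u : 0ℚ ≤ u)
  (moment : ∀ v → expect p (λ S → (u * u) ^ componentSize S v) [] (edges G) ≤ M) where

  -- `SizeBound` quantifies over all partial sums of the exponential series. This decidable
  -- condition replaces it in the event, and implies it by `u^≤⇒SizeBound` for the `u` of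
  -- `Parameters`.
  small : List (Edge n) → Fin n → Bool
  small S v = ⌊ u ^ componentSize S v ≤? ℕtoℚ n ⌋

  n² : ℚ
  n² = ℕtoℚ n * ℕtoℚ n

  0≤n² : 0ℚ ≤ n²
  0≤n² = 0≤a*b (0≤ℕtoℚ n) (0≤ℕtoℚ n)

  -- If `small S v` fails, u^|C(v)| exceeds n, so its square is at least n² and dominates the left
  -- side. Squaring `u` makes the loss per vertex of order 1/n², which survives a sum over n
  -- vertices. `b` stands for the event at the other vertices.
  markov : ∀ v (b : Bool) S →
    n² * indicator b ≤ n² * indicator (small S v ∧ b) + (u * u) ^ componentSize S v
  markov v b S with u ^ componentSize S v ≤? ℕtoℚ n
  ... | yes _ = a≤a+b (0≤^ (componentSize S v) (0≤a*b 0≤u 0≤u))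
  ... | no u^s≰n = begin
    n² * indicator b                    ≤⟨ *-monoʳ-≤ 0≤n² (indicator≤1 b) ⟩
    n² * 1ℚ                             ≡⟨ *-identityʳ n² ⟩
    n²                                  ≤⟨ *-mono-≤ (0≤ℕtoℚ n) (0≤^ s 0≤u) n≤u^s n≤u^s ⟩
    u ^ s * u ^ s                       ≡⟨ ^-distrib-* u u s ⟨
    (u * u) ^ s                         ≡⟨ +-identityˡ _ ⟨
    0ℚ + (u * u) ^ s                    ≡⟨ cong (_+ (u * u) ^ s) (*-zeroʳ n²) ⟨
    n² * 0ℚ + (u * u) ^ s               ∎
    where
    open ≤-Reasoning
    s = componentSize S v
    n≤u^s : ℕtoℚ n ≤ u ^ s
    n≤u^s = <⇒≤ (≰⇒> u^s≰n)
    indicator≤1 : ∀ b → indicator b ≤ 1ℚ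
    indicator≤1 true  = ≤-refl
    indicator≤1 false = 0≤1

  -- Vertices enter the event one at a time; by `markov` and `moment` each costs at most M/n² in
  -- probability.
  union : ∀ vs → n² ≤ n² * prob G p (λ S → all (small S) vs) + ℕtoℚ (length vs) * M
  union [] = ≤-reflexive (begin
    n²                                                   ≡⟨ solve 2 (λ c m → c := c :* con 1ℚ :+ con 0ℚ :* m) refl n² M ⟩
    n² * 1ℚ + 0ℚ * M                                     ≡⟨ cong (λ t → n² * t + 0ℚ * M) (expect-1 p [] (edges G)) ⟨
    n² * expect p (λ _ → 1ℚ) [] (edges G) + 0ℚ * M       ∎)
    where
    open ≡-Reasoning
    open +-*-Solver
  union (v ∷ vs) = begin
    n²                                  ≤⟨ union vs ⟩
    n² * P₀ + ℕtoℚ (length vs) * M      ≤⟨ +-monoˡ-≤ _ (≤-trans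
                                             (expect-≤-linear 0≤p p≤1 n² (λ S → markov v (all (small S) vs) S) [] (edges G))
                                             (+-monoʳ-≤ (n² * P₁) (moment v))) ⟩
    n² * P₁ + M + ℕtoℚ (length vs) * M  ≡⟨ solve 3 (λ q m k → q :+ m :+ k :* m := q :+ (con 1ℚ :+ k) :* m) refl (n² * P₁) M (ℕtoℚ (length vs)) ⟩
    n² * P₁ + (1ℚ + ℕtoℚ (length vs)) * M ≡⟨ cong (λ t → n² * P₁ + t * M) (ℕtoℚ-suc (length vs)) ⟨
    n² * P₁ + ℕtoℚ (suc (length vs)) * M ∎
    where
    open ≤-Reasoning
    open +-*-Solver
    P₀ = prob G p (λ S → all (small S) vs)
    P₁ = prob G p (λ S → all (small S) (v ∷ vs))

  prob-all-small : ∀ {δ} → 1 ℕ.≤ n → M ≤ ℕtoℚ n * δ → 1ℚ - δ ≤ prob G p (λ S → all (small S) (allFin n))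
  -- All n vertices together lose at most n M ≤ n² δ after scaling by n², which is positive because
  -- n ≥ 1.
  prob-all-small {δ} 1≤n M≤nδ = *-cancelˡ-≤-pos n² {{positive 0<n²}} (begin
    n² * (1ℚ - δ)                          ≡⟨ solve 2 (λ n d → n :* n :* (con 1ℚ :- d) := n :* n :+ (:- (n :* (n :* d)))) refl (ℕtoℚ n) δ ⟩
    n² - ℕtoℚ n * (ℕtoℚ n * δ)             ≤⟨ +-mono-≤ (union (allFin n)) (neg-antimono-≤ (*-monoʳ-≤ (0≤ℕtoℚ n) M≤nδ)) ⟩
    n² * P + ℕtoℚ (length (allFin n)) * M - ℕtoℚ n * M ≡⟨ cong (λ k → n² * P + ℕtoℚ k * M - ℕtoℚ n * M) (length-tabulate {n = n} (λ i → i)) ⟩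
    n² * P + ℕtoℚ n * M - ℕtoℚ n * M       ≡⟨ solve 2 (λ a b → a :+ b :- b := a) refl (n² * P) (ℕtoℚ n * M) ⟩
    n² * P                                 ∎)
    where
    open ≤-Reasoning
    open +-*-Solver
    P = prob G p (λ S → all (small S) (allFin n))
    1≤nℚ : 1ℚ ≤ ℕtoℚ n
    1≤nℚ = ℕtoℚ-mono-≤ 1≤n
    0<n² : 0ℚ < n²
    0<n² = <-≤-trans (positive⁻¹ 1ℚ) (*-mono-≤ 0≤1 (0≤ℕtoℚ n) 1≤nℚ 1≤nℚ)

theorem1 :
    Σ ℚ λ ε₀ → 0ℚ < ε₀ ×
      ((ε : ℚ) → 0ℚ < ε → ε < ε₀ →
        (δ : ℚ) → 0ℚ < δ →
          ∃ λ (N : ℕ) → (n : ℕ) → N ℕ.≤ n →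
            (G : Graph n) (d : ℕ) → 3 ℕ.≤ d → maxDegree G ≡ d →
              Σ (List (Edge n) → Bool) λ g →
                ((S : List (Edge n)) → g S ≡ true → AllComponentsSmall ε S)
                × (1ℚ - δ ≤ prob G (pOf ε d) g))
theorem1 = inv 5 , positive⁻¹ (inv 5) , λ ε 0<ε ε<1/5 δ 0<δ →
  -- 4 is the moment bound proved in `conclude`; the threshold `suc N` also ensures n ≥ 1.
  let N , large = archimedean 4 0<δ in
  suc N , λ n N<n G d 3≤d maxdeg → conclude ε 0<ε ε<1/5 δ n (ℕP.≤-trans (s≤s z≤n) N<n) (large (ℕP.<⇒≤ N<n)) G d 3≤d maxdeg
  where
  conclude : ∀ ε → 0ℚ < ε → ε < inv 5 → ∀ δ n → 1 ℕ.≤ n → ℕtoℚ 4 ≤ ℕtoℚ n * δ →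
    (G : Graph n) (d : ℕ) → 3 ℕ.≤ d → maxDegree G ≡ d →
    Σ (List (Edge n) → Bool) λ g →
      ((S : List (Edge n)) → g S ≡ true → AllComponentsSmall ε S) × (1ℚ - δ ≤ prob G (pOf ε d) g)
  conclude ε 0<ε ε<1/5 δ n 1≤n 4≤nδ G (suc (suc k)) (s≤s (s≤s _)) maxdeg =
      (λ S → all (small S) (allFin n))
    , (λ S h v → u^≤⇒SizeBound (componentSize S v) n (toWitness (subst T (sym (all-true⇒ (small S) h (∈-allFin v))) _)))
    , prob-all-small 1≤n 4≤nδ
    where
    open Parameters ε 0<ε ε<1/5
    open Degree k
    deg : ∀ c → count (touches c) (edges G) ℕ.≤ 2 ℕ.+ k
    deg c = ℕP.≤-trans (count-touches-edges≤degree G c) (ℕP.≤-trans (degree≤maxDegree G c) (ℕP.≤-reflexive maxdeg))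
    moment : ∀ v → expect p (λ S → z ^ componentSize S v) [] (edges G) ≤ ℕtoℚ 4
    moment v = ≤-trans (Exploration.expect-weight 0≤p p≤1 1≤z 0≤ε zw^[d-1]≤1+ε v (edges G) deg)
      -- Both factors of w (1 + ε) are at most 2, whence the bound 4.
      (*-mono-≤ (0≤a+b 0≤1 0≤ε) (≤-trans (≤-trans 0≤1 1≤w) w≤2) w≤2 (+-monoʳ-≤ 1ℚ ε≤1))
    open UnionBound G 0≤p p≤1 (≤-trans 0≤1 1≤u) moment
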